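{- For $2\le B\le 10$, the fixed points of $S_B$ and the cycles of $S_B$ of length at least $2$ are exactly the following (all numerals written in base $B$; "(and its conjugate)" means the cycle obtained by complex conjugation of every element is also a cycle; each listed cycle $z_0\to z_1\to\cdots\to z_0$ means $S_B(z_0)=z_1$, etc.): $B=2$: fixed points $0,1$; no other cycles. $B=3$: fixed points $0,1,12,22,2+11i,2-11i$; cycles $2\to 11\to 2$; $-1+2i\to -10-11i\to -1+2i$ (and its conjugate); $-11+22i\to -20-22i\to -11+22i$ (and its conjugate). $B=4$: fixed points $0,1$; no other cycles. $B=5$: fixed points $0,1,23,33$; cycles $4\to 31\to 20\to 4$; $3+11i\to 12+11i\to 3+11i$ (and its conjugate). $B=6$: fixed points $0,1$; cycle $5\to 41\to 25\to 45\to 105\to 42\to 32\to 21\to 5$. $B=7$: fixed points $0,1,13,34,44,63,25+31i,25-31i$; cycles $2\to 4\to 22\to 11\to 2$; $16\to 52\to 41\to 23\to 16$; $-15+116i\to -15-116i\to -15+116i$; $-31+44i\to -31-44i\to -31+44i$; $-11+51i\to -33-15i\to -11+51i$ (and its conjugate); $-21+26i\to -50-26i\to -21+26i$ (and its conjugate); $-1+13i\to -12-6i\to -43+33i\to 10-60i\to -50-15i\to -1+13i$ (and its conjugate); $4+22i\to 11+22i\to -6+11i\to 46-15i\to 35-125i\to 4-116i\to -31-66i\to -116+66i\to -46-150i\to 35+55i\to -22+143i\to -24-40i\to 4+22i$ (and its conjugate); $14+35i\to -23+64i\to -54-66i\to -43+213i\to 14-35i\to -23-64i\to -54+66i\to -43-213i\to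 14+35i$; $-13+15i\to -22-44i\to -33+44i\to -20-66i\to -125+33i\to 15-60i\to -13-15i\to -22+44i\to -33-44i\to -20+66i\to -125-33i\to 15+60i\to -13+15i$. $B=8$: fixed points $0,1,24,64,15+32i,15-32i,45+20i,45-20i$; cycles $4\to 20\to 4$; $15\to 32\to 15$; $5\to 31\to 12\to 5$; $-34+72i\to -34-72i\to -34+72i$; $-11+24i\to -22-14i\to -11+24i$ (and its conjugate); $-40+70i\to -41-70i\to -40+70i$ (and its conjugate); $4+6i\to -24+60i\to -20-30i\to -5+14i\to 10-50i\to -30-12i\to 4+6i$ (and its conjugate). $B=9$: fixed points $0,1,45,55$; cycles $75\to 82\to 75$; $58\to 108\to 72\to 58$; $-4+26i\to -26-53i\to 6+62i\to -4+26i$ (and its conjugate); $10+26i\to -43+4i\to 10-26i\to -43-4i\to 10+26i$. $B=10$: fixed points $0,1$; cycles $4\to 16\to 37\to 58\to 89\to 145\to 42\to 20\to 4$; $-52+90i\to -52-90i\to -52+90i$; $35+48i\to -46+104i\to 35-48i\to -46-104i\to 35+48i$; $-15+90i\to -55-18i\to -15+90i$ (and its conjugate).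
   Context: Fix an integer $B\ge 2$. Every nonzero Gaussian integer $a+bi$ is written uniquely as $a+bi=\sum_{j=0}^n (a_j+b_ji)B^j$ with $a_j,b_j\in\mathbb{Z}$, $a_n,b_n$ not both $0$, and for each $j$: $|a_j|\le B-1$, $|b_j|\le B-1$, $\operatorname{sgn}(a)a_j\ge 0$, $\operatorname{sgn}(b)b_j\ge 0$. The Gaussian $B$-happy function $S_B:\mathbb{Z}[i]\to\mathbb{Z}[i]$ is defined by $S_B(0)=0$ and $S_B(a+bi)=\sum_{j=0}^n (a_j+b_ji)^2$. A cycle of length $k$ is a set of $k$ distinct points $g_0,\dots,g_{k-1}$ with $S_B(g_j)=g_{j+1}$ ($j<k-1$) and $S_B(g_{k-1})=g_0$; fixed points are cycles of length 1. Notation: a numeral such as $-15+116i$ in base $7$ denotes $-(1\cdot 7+5)+(1\cdot 7^2+1\cdot 7+6)i$, i.e. the real and imaginary parts are given by their signs and the base-$B$ digit strings of their absolute values. -}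

module Defs where

open import Data.Nat as ℕ using (ℕ; zero; suc; _/_; _%_)
open import Data.Integer as ℤ using (ℤ; +_; -[1+_]; -_; ∣_∣; _+_; _-_; _*_)
open import Data.Integer.Literals as Lit
import Data.Nat.Literals as NLit
open import Data.Unit using (⊤; tt)
open import Agda.Builtin.FromNat using (Number; fromNat)
open import Agda.Builtin.FromNeg using (Negative; fromNeg)
open import Data.Product using (_×_; _,_; proj₁; proj₂)
open import Data.List using (List; []; _∷_; map; foldr; _++_; [_]; concat)

instance
  ℤnumber = Lit.number
  ℤnegative = Lit.negative
  ℕnumber = NLit.number

-- Gaussian integers a + b i, represented as pairs (a , b)

G : Set
G = ℤ × ℤ

gzero : G
gzero = (+ 0 , + 0)

_+G_ : G → G → G
(a , b) +G (c , d) = (a + c , b + d)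

sqG : G → G
sqG (a , b) = (a * a - b * b , + 2 * a * b)

conj : G → G
conj (a , b) = (a , - b)

-- Base-B digits of a natural number, least significant first, with no
-- leading (most significant) zeros; digits 0 = [].
-- Only used for B ≥ 2 (the fuel argument makes it total for all B).

divB : ℕ → ℕ → ℕ
divB zero    n = 0
divB (suc k) n = n / suc k

modB : ℕ → ℕ → ℕ
modB zero    n = n
modB (suc k) n = n % suc k

digitsF : ℕ → ℕ → ℕ → List ℕ
digitsF B zero    n       = []
digitsF B (suc f) zero    = []
digitsF B (suc f) (suc n) = modB B (suc n) ∷ digitsF B f (divB B (suc n))

digits : ℕ → ℕ → List ℕ
digits B n = digitsF B n n

sdigits : ℕ → ℤ → List ℤ
sdigits B (+ n)      = map +_ (digits B n)
sdigits B -[1+ n ]   = map (λ d → - (+ d)) (digits B (suc n))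

zipPad : List ℤ → List ℤ → List G
zipPad []       []       = []
zipPad []       (y ∷ ys) = (+ 0 , y) ∷ zipPad [] ys
zipPad (x ∷ xs) []       = (x , + 0) ∷ zipPad xs []
zipPad (x ∷ xs) (y ∷ ys) = (x , y) ∷ zipPad xs ys

gdigits : ℕ → G → List G
gdigits B (a , b) = zipPad (sdigits B a) (sdigits B b)

-- The Gaussian B-happy function S_B(a + bi) = Σ_j (a_j + b_j i)^2
-- (S_B(0) = 0 since 0 has no digits).
S : ℕ → G → G
S B z = foldr (λ d acc → sqG d +G acc) gzero (gdigits B z)

rotate : {A : Set} → ℕ → List A → List A
rotate zero    xs       = xs
rotate (suc k) []       = []
rotate (suc k) (x ∷ xs) = rotate k (xs ++ [ x ])

-- Numerals as in the paper: the decimal digit string of the literal is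
-- read as a base-B digit string, the sign is kept.  E.g.
-- num 7 -15 = -(1·7+5),  num 7 116 = 1·7²+1·7+6.

readF : ℕ → ℕ → ℕ → ℕ
readF B zero    n = 0
readF B (suc f) n = n % 10 ℕ.+ B ℕ.* readF B f (n / 10)

readN : ℕ → ℕ → ℕ
readN B n = readF B n n

num : ℕ → ℤ → ℤ
num B (+ n)    = + readN B n
num B -[1+ n ] = - (+ readN B (suc n))

z : ℕ → ℤ → ℤ → G
z B re im = (num B re , num B im)

withConj : List G → List (List G)
withConj c = c ∷ map conj c ∷ []

listed : ℕ → List (List G)
listed 2 = [ z 2 0 0 ] ∷ [ z 2 1 0 ] ∷ []
listed 3 = concat
  ( ([ z 3 0 0 ] ∷ [ z 3 1 0 ] ∷ [ z 3 12 0 ] ∷ [ z 3 22 0 ]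
      ∷ [ z 3 2 11 ] ∷ [ z 3 2 -11 ] ∷ [])
  ∷ [ z 3 2 0 ∷ z 3 11 0 ∷ [] ]
  ∷ withConj (z 3 -1 2 ∷ z 3 -10 -11 ∷ [])
  ∷ withConj (z 3 -11 22 ∷ z 3 -20 -22 ∷ [])
  ∷ [])
listed 4 = [ z 4 0 0 ] ∷ [ z 4 1 0 ] ∷ []
listed 5 = concat
  ( ([ z 5 0 0 ] ∷ [ z 5 1 0 ] ∷ [ z 5 23 0 ] ∷ [ z 5 33 0 ] ∷ [])
  ∷ [ z 5 4 0 ∷ z 5 31 0 ∷ z 5 20 0 ∷ [] ]
  ∷ withConj (z 5 3 11 ∷ z 5 12 11 ∷ [])
  ∷ [])
listed 6 =
  [ z 6 0 0 ] ∷ [ z 6 1 0 ]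
  ∷ (z 6 5 0 ∷ z 6 41 0 ∷ z 6 25 0 ∷ z 6 45 0 ∷ z 6 105 0 ∷ z 6 42 0
      ∷ z 6 32 0 ∷ z 6 21 0 ∷ [])
  ∷ []
listed 7 = concat
  ( ([ z 7 0 0 ] ∷ [ z 7 1 0 ] ∷ [ z 7 13 0 ] ∷ [ z 7 34 0 ] ∷ [ z 7 44 0 ]
      ∷ [ z 7 63 0 ] ∷ [ z 7 25 31 ] ∷ [ z 7 25 -31 ] ∷ [])
  ∷ [ z 7 2 0 ∷ z 7 4 0 ∷ z 7 22 0 ∷ z 7 11 0 ∷ [] ]
  ∷ [ z 7 16 0 ∷ z 7 52 0 ∷ z 7 41 0 ∷ z 7 23 0 ∷ [] ]
  ∷ [ z 7 -15 116 ∷ z 7 -15 -116 ∷ [] ]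
  ∷ [ z 7 -31 44 ∷ z 7 -31 -44 ∷ [] ]
  ∷ withConj (z 7 -11 51 ∷ z 7 -33 -15 ∷ [])
  ∷ withConj (z 7 -21 26 ∷ z 7 -50 -26 ∷ [])
  ∷ withConj (z 7 -1 13 ∷ z 7 -12 -6 ∷ z 7 -43 33 ∷ z 7 10 -60
               ∷ z 7 -50 -15 ∷ [])
  ∷ withConj (z 7 4 22 ∷ z 7 11 22 ∷ z 7 -6 11 ∷ z 7 46 -15 ∷ z 7 35 -125
               ∷ z 7 4 -116 ∷ z 7 -31 -66 ∷ z 7 -116 66 ∷ z 7 -46 -150
               ∷ z 7 35 55 ∷ z 7 -22 143 ∷ z 7 -24 -40 ∷ [])
  ∷ [ z 7 14 35 ∷ z 7 -23 64 ∷ z 7 -54 -66 ∷ z 7 -43 213 ∷ z 7 14 -35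
        ∷ z 7 -23 -64 ∷ z 7 -54 66 ∷ z 7 -43 -213 ∷ [] ]
  ∷ [ z 7 -13 15 ∷ z 7 -22 -44 ∷ z 7 -33 44 ∷ z 7 -20 -66 ∷ z 7 -125 33
        ∷ z 7 15 -60 ∷ z 7 -13 -15 ∷ z 7 -22 44 ∷ z 7 -33 -44
        ∷ z 7 -20 66 ∷ z 7 -125 -33 ∷ z 7 15 60 ∷ [] ]
  ∷ [])
listed 8 = concat
  ( ([ z 8 0 0 ] ∷ [ z 8 1 0 ] ∷ [ z 8 24 0 ] ∷ [ z 8 64 0 ] ∷ [ z 8 15 32 ]
      ∷ [ z 8 15 -32 ] ∷ [ z 8 45 20 ] ∷ [ z 8 45 -20 ] ∷ [])
  ∷ [ z 8 4 0 ∷ z 8 20 0 ∷ [] ]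
  ∷ [ z 8 15 0 ∷ z 8 32 0 ∷ [] ]
  ∷ [ z 8 5 0 ∷ z 8 31 0 ∷ z 8 12 0 ∷ [] ]
  ∷ [ z 8 -34 72 ∷ z 8 -34 -72 ∷ [] ]
  ∷ withConj (z 8 -11 24 ∷ z 8 -22 -14 ∷ [])
  ∷ withConj (z 8 -40 70 ∷ z 8 -41 -70 ∷ [])
  ∷ withConj (z 8 4 6 ∷ z 8 -24 60 ∷ z 8 -20 -30 ∷ z 8 -5 14 ∷ z 8 10 -50
               ∷ z 8 -30 -12 ∷ [])
  ∷ [])
listed 9 = concat
  ( ([ z 9 0 0 ] ∷ [ z 9 1 0 ] ∷ [ z 9 45 0 ] ∷ [ z 9 55 0 ] ∷ [])
  ∷ [ z 9 75 0 ∷ z 9 82 0 ∷ [] ]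
  ∷ [ z 9 58 0 ∷ z 9 108 0 ∷ z 9 72 0 ∷ [] ]
  ∷ withConj (z 9 -4 26 ∷ z 9 -26 -53 ∷ z 9 6 62 ∷ [])
  ∷ [ z 9 10 26 ∷ z 9 -43 4 ∷ z 9 10 -26 ∷ z 9 -43 -4 ∷ [] ]
  ∷ [])
listed 10 = concat
  ( ([ z 10 0 0 ] ∷ [ z 10 1 0 ] ∷ [])
  ∷ [ z 10 4 0 ∷ z 10 16 0 ∷ z 10 37 0 ∷ z 10 58 0 ∷ z 10 89 0
        ∷ z 10 145 0 ∷ z 10 42 0 ∷ z 10 20 0 ∷ [] ]
  ∷ [ z 10 -52 90 ∷ z 10 -52 -90 ∷ [] ]
  ∷ [ z 10 35 48 ∷ z 10 -46 104 ∷ z 10 35 -48 ∷ z 10 -46 -104 ∷ [] ]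
  ∷ withConj (z 10 -15 90 ∷ z 10 -55 -18 ∷ [])
  ∷ [])
listed _ = []

{-# OPTIONS --safe #-}
module Submission where

-- The absolute values of the two coordinates of S B x depend only on those of x; this gives a map magS B on ℕ × ℕ.
-- By AM-GM, the coordinates of magS B (p , q) add up to at most twice the larger of the digit square sums of p and q,
-- so magS B strictly decreases p + q outside a box [0, N)². Inside the box a computation shows that every orbit of magS B
-- either drops below its initial size or reaches the absolute values of a listed point. By well-founded induction
-- every orbit of S B reaches a listed point, hence every periodic point is listed, and two cycles with a common
-- point are rotations of each other.

open import Defs
open import Data.Nat using (ℕ; _≤_)
open import Data.List using (List; []; map)
open import Data.List.Relation.Unary.Any using (Any)
open import Data.List.Relation.Unary.Unique.Propositional using (Unique)
open import Data.Product using (_×_; ∃)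
open import Function.Bundles using (_⇔_)
open import Relation.Binary.PropositionalEquality using (_≡_; _≢_)

open import Data.Bool using (Bool; T; _∨_)
open import Data.Bool.ListAction using (all)
open import Data.Bool.Properties using (T-∨)
open import Data.Nat using (zero; suc; _+_; _*_; _∸_; _/_; _%_; _<_; _<?_; _≤?_; _<ᵇ_; z≤n; s≤s)
open import Data.Nat.DivMod using (m≡m%n+[m/n]*n; m%n<n; m/n<m; m*n/n≡m; /-monoˡ-≤)
open import Data.Nat.GeneralisedArithmetic using (fold; fold-+)
open import Data.Nat.Induction using (<-wellFounded; <-rec)
import Data.Nat.Properties as ℕ
import Data.Nat.Tactic.RingSolver as ℕSolver
open import Data.Integer as ℤ using (ℤ; +_; -[1+_]; ∣_∣)
import Data.Integer.Properties as ℤ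
import Data.Integer.Tactic.RingSolver as ℤSolver
open import Data.List using (_∷_; [_]; _++_; concat; downFrom; length; foldr)
import Data.List.Properties as List
open import Data.List.Membership.Propositional using (_∈_; lose)
open import Data.List.Membership.Propositional.Properties using (∈-∃++; ∈-map⁺; ∈-concat⁻′; ∈-downFrom⁺)
import Data.List.Membership.DecPropositional as DecMembership
open import Data.List.Relation.Binary.Permutation.Propositional using (↭⇒↭ₛ)
open import Data.List.Relation.Binary.Permutation.Propositional.Properties using (∷↭∷ʳ)
import Data.List.Relation.Binary.Permutation.Setoid.Properties as Permutationₛ
open import Data.List.Relation.Unary.All as All using (All; []; _∷_)
import Data.List.Relation.Unary.All.Properties as All
open import Data.List.Relation.Unary.AllPairs using (_∷_)
open import Data.List.Relation.Unary.Any using (here; there)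
open import Data.List.Relation.Unary.Unique.DecPropositional using (unique?)
open import Data.Product using (_,_; proj₁; proj₂)
import Data.Product.Properties as Product
open import Data.Sign using (Sign)
open import Data.Sum using (_⊎_; inj₁; inj₂; [_,_]′)
open import Function.Bundles using (Equivalence; mk⇔)
open import Induction.WellFounded using (Acc; acc)
open import Relation.Binary.Definitions using (DecidableEquality)
open import Relation.Binary.PropositionalEquality using (refl; sym; trans; cong; cong₂; subst; subst₂; module ≡-Reasoning)
open import Relation.Binary.PropositionalEquality.Properties using (setoid)
open import Relation.Nullary using (Dec; yes; no; contradiction)
open import Relation.Nullary.Decidable using (toWitness; True; _⊎-dec_; _×-dec_; ¬?; ⌊_⌋; T?)

-- Cycles of a self-map

module _ {A : Set} (f : A → A) where

  IsCycle : List A → Set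
  IsCycle l = l ≢ [] × Unique l × map f l ≡ rotate 1 l

  isCycle? : DecidableEquality A → ∀ l → Dec (IsCycle l)
  isCycle? _≟_ l = ¬? (List.≡-dec _≟_ l []) ×-dec unique? _≟_ l ×-dec List.≡-dec _≟_ (map f l) (rotate 1 l)

  -- One rotation suffices. It permutes the entries, so distinctness survives, and `map f` commutes
  -- with rotation, so the cycle equation can be rotated on both sides.
  isCycle-rotate : ∀ k {l} → IsCycle l → IsCycle (rotate k l)
  isCycle-rotate zero            c             = c
  isCycle-rotate (suc k) {[]}    (ne , _)      = contradiction refl ne
  isCycle-rotate (suc k) {x ∷ l} (_ , u , eq) = isCycle-rotate k (nonEmpty l , unique , step)
    where
    nonEmpty : ∀ l → l ++ [ x ] ≢ []
    nonEmpty []      ()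
    nonEmpty (_ ∷ _) ()

    unique : Unique (l ++ [ x ])
    unique = Permutationₛ.Unique-resp-↭ (setoid A) (↭⇒↭ₛ (∷↭∷ʳ x l)) u

    step : map f (l ++ [ x ]) ≡ rotate 1 (l ++ [ x ])
    step = trans (List.map-++ f l [ x ]) (cong (rotate 1) eq)

  -- The hypothesis encodes a path: each entry of `x ∷ l` maps to the next, and the last one maps to
  -- `w`. For `w = x` it is the cycle equation, so the head of a cycle is periodic.
  iterate-path : ∀ x l {w} → map f (x ∷ l) ≡ l ++ [ w ] → fold x f (suc (length l)) ≡ w
  iterate-path x []      eq = List.∷-injectiveˡ eq
  iterate-path x (y ∷ l) {w} eq = begin
    fold x f (suc (suc (length l)))   ≡⟨ cong (fold x f) (ℕ.+-comm 1 (suc (length l))) ⟩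
    fold x f (suc (length l) + 1)     ≡⟨ fold-+ x f (suc (length l)) ⟩
    fold (f x) f (suc (length l))     ≡⟨ cong (λ v → fold v f (suc (length l))) (List.∷-injectiveˡ eq) ⟩
    fold y f (suc (length l))         ≡⟨ iterate-path y l (List.∷-injectiveʳ eq) ⟩
    w                                 ∎
    where open ≡-Reasoning

  -- Both lists follow the orbit of `x` and stop at its first arrival at `w`. Since `w` occurs in
  -- neither tail, neither can stop earlier than the other.
  path-unique : ∀ x l m {w} → All (w ≢_) l → All (w ≢_) m →
                map f (x ∷ l) ≡ l ++ [ w ] → map f (x ∷ m) ≡ m ++ [ w ] → l ≡ m
  path-unique x []      []      _ _ _ _ = refl
  path-unique x []      (y ∷ m) _ (w≢y ∷ _) p q =
    contradiction (trans (sym (List.∷-injectiveˡ p)) (List.∷-injectiveˡ q)) w≢y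
  path-unique x (y ∷ l) []      (w≢y ∷ _) _ p q =
    contradiction (trans (sym (List.∷-injectiveˡ q)) (List.∷-injectiveˡ p)) w≢y
  path-unique x (y ∷ l) (y′ ∷ m) (_ ∷ w∉l) (_ ∷ w∉m) p q
    with refl ← trans (sym (List.∷-injectiveˡ p)) (List.∷-injectiveˡ q) =
    cong (y ∷_) (path-unique y l m w∉l w∉m (List.∷-injectiveʳ p) (List.∷-injectiveʳ q))

  cycle-unique : ∀ {x l m} → IsCycle (x ∷ l) → IsCycle (x ∷ m) → x ∷ l ≡ x ∷ m
  cycle-unique (_ , x∉l ∷ _ , p) (_ , x∉m ∷ _ , q) = cong (_ ∷_) (path-unique _ _ _ x∉l x∉m p q)

  Absorbs : (A → Set) → Set
  Absorbs P = ∀ x → P x → P (f x)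

  Eventually : (A → Set) → A → Set
  Eventually P x = ∃ λ n → P (fold x f n)

  eventually-step : ∀ {P x} → Eventually P (f x) → Eventually P x
  eventually-step {P} {x} (n , p) = suc n , subst P (trans (sym (fold-+ x f n)) (cong (fold x f) (ℕ.+-comm n 1))) p

  eventually-fold : ∀ {P x} n → Eventually P (fold x f n) → Eventually P x
  eventually-fold         zero    e = e
  eventually-fold {P} {x} (suc n) e = eventually-fold {P} n (eventually-step {P} e)

  absorbs-fold : ∀ {P x} → Absorbs P → ∀ n → P x → P (fold x f n)
  absorbs-fold         P-absorbs zero    p = p
  absorbs-fold {P} {x} P-absorbs (suc n) p = P-absorbs (fold x f n) (absorbs-fold {P} P-absorbs n p)

  fold-period : ∀ {x n} → fold x f n ≡ x → ∀ k → fold x f (k * n) ≡ x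
  fold-period             eq zero    = refl
  fold-period {x} {n} eq (suc k) =
    trans (fold-+ x f n) (trans (cong (λ v → fold v f n) (fold-period eq k)) eq)

  periodic-absorbed : ∀ {P x n} → Absorbs P → fold x f (suc n) ≡ x → Eventually P x → P x
  periodic-absorbed {P} {x} {n} P-absorbs eq (k , p) =
    -- The orbit is in `P` after `k` steps. Another `k * n` steps stay in `P` and make `k * suc n`
    -- in total, a multiple of the period.
    subst P (trans (sym (fold-+ x f (k * n))) returns) (absorbs-fold {P} P-absorbs (k * n) p)
    where
    returns : fold x f (k * n + k) ≡ x
    returns = trans (cong (fold x f) (trans (ℕ.+-comm (k * n) k) (sym (ℕ.*-suc k n))))
                    (fold-period eq k)

rotate-++ : ∀ {A : Set} (xs ys : List A) → rotate (length xs) (xs ++ ys) ≡ ys ++ xs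
rotate-++ []       ys = sym (List.++-identityʳ ys)
rotate-++ (x ∷ xs) ys = begin
  rotate (length xs) ((xs ++ ys) ++ [ x ]) ≡⟨ cong (rotate (length xs)) (List.++-assoc xs ys [ x ]) ⟩
  rotate (length xs) (xs ++ ys ++ [ x ])   ≡⟨ rotate-++ xs (ys ++ [ x ]) ⟩
  (ys ++ [ x ]) ++ xs                      ≡⟨ List.++-assoc ys [ x ] xs ⟩
  ys ++ x ∷ xs                             ∎
  where open ≡-Reasoning

rotate-to : ∀ {A : Set} {x : A} {l} → x ∈ l → ∃ λ k → ∃ λ m → rotate k l ≡ x ∷ m
rotate-to {x = x} x∈l with ys , zs , refl ← ∈-∃++ x∈l = length ys , zs ++ ys , rotate-++ ys (x ∷ zs)

-- The induced map on absolute values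

-- Truncating at the shorter list is right because `zipPad` fills up with zeros, which add nothing
-- to a product.
inner : List ℕ → List ℕ → ℕ
inner []       ys       = 0
inner (x ∷ xs) []       = 0
inner (x ∷ xs) (y ∷ ys) = x * y + inner xs ys

inner-[] : ∀ xs → inner xs [] ≡ 0
inner-[] []       = refl
inner-[] (x ∷ xs) = refl

normSq : List ℕ → ℕ
normSq xs = inner xs xs

Mag : Set
Mag = ℕ × ℕ

size : Mag → ℕ
size (p , q) = p + q

mag : G → Mag
mag (a , b) = ∣ a ∣ , ∣ b ∣

-- The first component is |normSq xs − normSq ys|, written with built-in operations only.
magSq : List ℕ → List ℕ → Mag
magSq xs ys = (normSq xs ∸ normSq ys) + (normSq ys ∸ normSq xs) , 2 * inner xs ys

magS : ℕ → Mag → Mag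
magS B (p , q) = magSq (digits B p) (digits B q)

unit : Sign → ℤ
unit Sign.+ = + 1
unit Sign.- = -[1+ 0 ]

-- The sign is a factor 1 or -1, so that the ring solver can treat it as a variable.
signed : Sign → ℕ → ℤ
signed σ n = unit σ ℤ.* + n

unit-square : ∀ σ → unit σ ℤ.* unit σ ≡ + 1
unit-square Sign.+ = refl
unit-square Sign.- = refl

∣unit∣ : ∀ σ → ∣ unit σ ∣ ≡ 1
∣unit∣ Sign.+ = refl
∣unit∣ Sign.- = refl

sdigits-signed : ∀ B a → sdigits B a ≡ map (signed (ℤ.sign a)) (digits B ∣ a ∣)
sdigits-signed B (+ n)    = List.map-cong (λ d → sym (ℤ.*-identityˡ (+ d))) (digits B n)
sdigits-signed B -[1+ n ] = List.map-cong (λ d → sym (ℤ.-1*i≡-i (+ d))) (digits B (suc n))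

signed-square : ∀ σ n → signed σ n ℤ.* signed σ n ≡ + (n * n)
signed-square σ n = begin
  unit σ ℤ.* + n ℤ.* (unit σ ℤ.* + n)   ≡⟨ rearrange (unit σ) (+ n) ⟩
  unit σ ℤ.* unit σ ℤ.* (+ n ℤ.* + n)   ≡⟨ cong (ℤ._* (+ n ℤ.* + n)) (unit-square σ) ⟩
  + 1 ℤ.* (+ n ℤ.* + n)                 ≡⟨ ℤ.*-identityˡ (+ n ℤ.* + n) ⟩
  + n ℤ.* + n                           ≡⟨ ℤ.pos-* n n ⟨
  + (n * n)                             ∎
  where
  open ≡-Reasoning
  rearrange : ∀ u x → u ℤ.* x ℤ.* (u ℤ.* x) ≡ u ℤ.* u ℤ.* (x ℤ.* x)
  rearrange = ℤSolver.solve-∀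

sumSq : List G → G
sumSq = foldr (λ d s → sqG d +G s) gzero

-- Squaring one digit pair gives real part x² - y², where the signs square to 1, and imaginary part
-- 2xy times the product of the two signs. That product is the same for all digits and factors out
-- of the sum.
sumSq-zipPad : ∀ σ τ xs ys →
  sumSq (zipPad (map (signed σ) xs) (map (signed τ) ys)) ≡
  (+ normSq xs ℤ.- + normSq ys , unit σ ℤ.* unit τ ℤ.* + (2 * inner xs ys))
sumSq-zipPad σ τ [] [] = cong (+ 0 ,_) (sym (ℤ.*-zeroʳ (unit σ ℤ.* unit τ)))
sumSq-zipPad σ τ [] (y ∷ ys) rewrite sumSq-zipPad σ τ [] ys | signed-square τ y =
  cong₂ _,_ (re (+ (y * y)) (+ normSq ys)) (im (signed τ y) (unit σ ℤ.* unit τ))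
  where
  re : ∀ a b → + 0 ℤ.- a ℤ.+ (+ 0 ℤ.- b) ≡ + 0 ℤ.- (a ℤ.+ b)
  re = ℤSolver.solve-∀
  im : ∀ a b → + 2 ℤ.* + 0 ℤ.* a ℤ.+ b ℤ.* + 0 ≡ b ℤ.* + 0
  im = ℤSolver.solve-∀
sumSq-zipPad σ τ (x ∷ xs) [] rewrite sumSq-zipPad σ τ xs [] | signed-square σ x | inner-[] xs =
  cong₂ _,_ (re (+ (x * x)) (+ normSq xs)) (im (signed σ x) (unit σ ℤ.* unit τ))
  where
  re : ∀ a b → a ℤ.- + 0 ℤ.+ (b ℤ.- + 0) ≡ a ℤ.+ b ℤ.- + 0
  re = ℤSolver.solve-∀
  im : ∀ a b → + 2 ℤ.* a ℤ.* + 0 ℤ.+ b ℤ.* + 0 ≡ b ℤ.* + 0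
  im = ℤSolver.solve-∀
sumSq-zipPad σ τ (x ∷ xs) (y ∷ ys)
  rewrite sumSq-zipPad σ τ xs ys | signed-square σ x | signed-square τ y =
  cong₂ _,_ (re (+ (x * x)) (+ (y * y)) (+ normSq xs) (+ normSq ys)) (begin
    + 2 ℤ.* signed σ x ℤ.* signed τ y ℤ.+ u ℤ.* v ℤ.* + (2 * i)
      ≡⟨ cong (λ t → + 2 ℤ.* signed σ x ℤ.* signed τ y ℤ.+ u ℤ.* v ℤ.* t) (ℤ.pos-* 2 i) ⟩
    + 2 ℤ.* signed σ x ℤ.* signed τ y ℤ.+ u ℤ.* v ℤ.* (+ 2 ℤ.* + i)
      ≡⟨ im u v (+ x) (+ y) (+ i) ⟩
    u ℤ.* v ℤ.* (+ 2 ℤ.* (+ x ℤ.* + y ℤ.+ + i))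
      ≡⟨ cong (λ t → u ℤ.* v ℤ.* (+ 2 ℤ.* (t ℤ.+ + i))) (ℤ.pos-* x y) ⟨
    u ℤ.* v ℤ.* (+ 2 ℤ.* + (x * y + i))
      ≡⟨ cong (λ t → u ℤ.* v ℤ.* t) (ℤ.pos-* 2 (x * y + i)) ⟨
    u ℤ.* v ℤ.* + (2 * (x * y + i)) ∎)
  where
  open ≡-Reasoning
  u = unit σ
  v = unit τ
  i = inner xs ys
  re : ∀ a b c d → a ℤ.- b ℤ.+ (c ℤ.- d) ≡ a ℤ.+ c ℤ.- (b ℤ.+ d)
  re = ℤSolver.solve-∀
  im : ∀ u v a b c → + 2 ℤ.* (u ℤ.* a) ℤ.* (v ℤ.* b) ℤ.+ u ℤ.* v ℤ.* (+ 2 ℤ.* c) ≡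
                     u ℤ.* v ℤ.* (+ 2 ℤ.* (a ℤ.* b ℤ.+ c))
  im = ℤSolver.solve-∀

∣+m-+n∣ : ∀ m n → ∣ + m ℤ.- + n ∣ ≡ (m ∸ n) + (n ∸ m)
∣+m-+n∣ m n with ℕ.≤-total m n
... | inj₁ m≤n = begin
  ∣ + m ℤ.- + n ∣   ≡⟨ cong ∣_∣ (ℤ.m-n≡m⊖n m n) ⟩
  ∣ m ℤ.⊖ n ∣       ≡⟨ ℤ.∣⊖∣-≤ m≤n ⟩
  n ∸ m             ≡⟨ cong (_+ (n ∸ m)) (ℕ.m≤n⇒m∸n≡0 m≤n) ⟨
  (m ∸ n) + (n ∸ m) ∎
  where open ≡-Reasoning
... | inj₂ n≤m = begin
  ∣ + m ℤ.- + n ∣   ≡⟨ cong ∣_∣ (ℤ.m-n≡m⊖n m n) ⟩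
  ∣ m ℤ.⊖ n ∣       ≡⟨ ℤ.∣m⊖n∣≡∣n⊖m∣ m n ⟩
  ∣ n ℤ.⊖ m ∣       ≡⟨ ℤ.∣⊖∣-≤ n≤m ⟩
  m ∸ n             ≡⟨ ℕ.+-identityʳ (m ∸ n) ⟨
  (m ∸ n) + 0       ≡⟨ cong (λ k → (m ∸ n) + k) (ℕ.m≤n⇒m∸n≡0 n≤m) ⟨
  (m ∸ n) + (n ∸ m) ∎
  where open ≡-Reasoning

∣unit*unit*+n∣ : ∀ σ τ n → ∣ unit σ ℤ.* unit τ ℤ.* + n ∣ ≡ n
∣unit*unit*+n∣ σ τ n = begin
  ∣ unit σ ℤ.* unit τ ℤ.* + n ∣   ≡⟨ ℤ.abs-* (unit σ ℤ.* unit τ) (+ n) ⟩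
  ∣ unit σ ℤ.* unit τ ∣ * n       ≡⟨ cong (_* n) (ℤ.abs-* (unit σ) (unit τ)) ⟩
  ∣ unit σ ∣ * ∣ unit τ ∣ * n     ≡⟨ cong₂ (λ u v → u * v * n) (∣unit∣ σ) (∣unit∣ τ) ⟩
  1 * 1 * n                       ≡⟨ ℕ.*-identityˡ n ⟩
  n                               ∎
  where open ≡-Reasoning

mag-S : ∀ B x → mag (S B x) ≡ magS B (mag x)
mag-S B (a , b) rewrite sdigits-signed B a | sdigits-signed B b
                      | sumSq-zipPad (ℤ.sign a) (ℤ.sign b) (digits B ∣ a ∣) (digits B ∣ b ∣) =
  cong₂ _,_ (∣+m-+n∣ (normSq (digits B ∣ a ∣)) (normSq (digits B ∣ b ∣)))
            (∣unit*unit*+n∣ (ℤ.sign a) (ℤ.sign b) _)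

mag-fold-S : ∀ B x n → mag (fold x (S B) n) ≡ fold (mag x) (magS B) n
mag-fold-S B x zero    = refl
mag-fold-S B x (suc n) = trans (mag-S B (fold x (S B) n)) (cong (magS B) (mag-fold-S B x n))

-- Growth of magS

-- If the larger number is the smaller plus `k`, the two sides differ by `k * k`.
2xy≤x²+y² : ∀ x y → 2 * (x * y) ≤ x * x + y * y
2xy≤x²+y² x y = [ ordered x y , swapped ]′ (ℕ.≤-total x y)
  where
  identity : ∀ x k → 2 * (x * (x + k)) + k * k ≡ x * x + (x + k) * (x + k)
  identity = ℕSolver.solve-∀

  ordered : ∀ x y → x ≤ y → 2 * (x * y) ≤ x * x + y * y
  ordered x y x≤y = subst (λ y → 2 * (x * y) ≤ x * x + y * y) (ℕ.m+[n∸m]≡n x≤y)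
    (subst (2 * (x * (x + k)) ≤_) (identity x k) (ℕ.m≤m+n _ (k * k)))
    where k = y ∸ x

  swapped : y ≤ x → 2 * (x * y) ≤ x * x + y * y
  swapped y≤x = subst₂ _≤_ (cong (2 *_) (ℕ.*-comm y x)) (ℕ.+-comm (y * y) (x * x)) (ordered y x y≤x)

2inner≤normSq+normSq : ∀ xs ys → 2 * inner xs ys ≤ normSq xs + normSq ys
2inner≤normSq+normSq []       ys       = z≤n
2inner≤normSq+normSq (x ∷ xs) []       = z≤n
2inner≤normSq+normSq (x ∷ xs) (y ∷ ys) = begin
  2 * (x * y + inner xs ys)                   ≡⟨ ℕ.*-distribˡ-+ 2 (x * y) (inner xs ys) ⟩
  2 * (x * y) + 2 * inner xs ys               ≤⟨ ℕ.+-mono-≤ (2xy≤x²+y² x y) (2inner≤normSq+normSq xs ys) ⟩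
  x * x + y * y + (normSq xs + normSq ys)     ≡⟨ interchange (x * x) (y * y) (normSq xs) (normSq ys) ⟩
  x * x + normSq xs + (y * y + normSq ys)     ∎
  where
  open ℕ.≤-Reasoning
  interchange : ∀ a b c d → a + b + (c + d) ≡ a + c + (b + d)
  interchange = ℕSolver.solve-∀

-- Let a and c be the two square sums with a ≥ c. The first coordinate is a - c and the second is at
-- most a + c, so together they give at most 2a.
size-magSq≤ : ∀ xs ys → size (magSq xs ys) ≤ 2 * normSq xs ⊎ size (magSq xs ys) ≤ 2 * normSq ys
size-magSq≤ xs ys with ℕ.≤-total (normSq ys) (normSq xs)
... | inj₁ c≤a = inj₁ (begin
  a ∸ c + (c ∸ a) + 2 * inner xs ys  ≡⟨ cong (λ k → a ∸ c + k + 2 * inner xs ys) (ℕ.m≤n⇒m∸n≡0 c≤a) ⟩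
  a ∸ c + 0 + 2 * inner xs ys        ≤⟨ ℕ.+-monoʳ-≤ (a ∸ c + 0) (2inner≤normSq+normSq xs ys) ⟩
  a ∸ c + 0 + (a + c)                ≡⟨ rearrange (a ∸ c) a c ⟩
  a ∸ c + c + a                      ≡⟨ cong (_+ a) (ℕ.m∸n+n≡m c≤a) ⟩
  a + a                              ≡⟨ cong (λ k → a + k) (ℕ.+-identityʳ a) ⟨
  2 * a                              ∎)
  where
  open ℕ.≤-Reasoning
  a = normSq xs
  c = normSq ys
  rearrange : ∀ d a c → d + 0 + (a + c) ≡ d + c + a
  rearrange = ℕSolver.solve-∀
... | inj₂ a≤c = inj₂ (begin
  a ∸ c + (c ∸ a) + 2 * inner xs ys  ≡⟨ cong (λ k → k + (c ∸ a) + 2 * inner xs ys) (ℕ.m≤n⇒m∸n≡0 a≤c) ⟩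
  c ∸ a + 2 * inner xs ys            ≤⟨ ℕ.+-monoʳ-≤ (c ∸ a) (2inner≤normSq+normSq xs ys) ⟩
  c ∸ a + (a + c)                    ≡⟨ ℕ.+-assoc (c ∸ a) a c ⟨
  c ∸ a + a + c                      ≡⟨ cong (_+ c) (ℕ.m∸n+n≡m a≤c) ⟩
  c + c                              ≡⟨ cong (λ k → c + k) (ℕ.+-identityʳ c) ⟨
  2 * c                              ∎)
  where
  open ℕ.≤-Reasoning
  a = normSq xs
  c = normSq ys

-- Digit square sums compared with the number itself

quotient≤ : ∀ b n → suc n / (2 + b) ≤ n
quotient≤ b n = ℕ.≤-pred (m/n<m (suc n) (2 + b) (s≤s (s≤s z≤n)))

-- Division by a base of at least 2 lowers a positive number, so any fuel of at least `n` outlasts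
-- the digits. This lets the tail of a digit list be read as `digits` of the quotient, whose own
-- fuel is smaller.
digitsF-fuel : ∀ b f g n → n ≤ f → n ≤ g → digitsF (2 + b) f n ≡ digitsF (2 + b) g n
digitsF-fuel b zero    zero    zero    _ _ = refl
digitsF-fuel b zero    (suc g) zero    _ _ = refl
digitsF-fuel b (suc f) zero    zero    _ _ = refl
digitsF-fuel b (suc f) (suc g) zero    _ _ = refl
digitsF-fuel b (suc f) (suc g) (suc n) (s≤s n≤f) (s≤s n≤g) =
  cong (suc n % (2 + b) ∷_)
    (digitsF-fuel b f g (suc n / (2 + b)) (ℕ.≤-trans (quotient≤ b n) n≤f) (ℕ.≤-trans (quotient≤ b n) n≤g))

digits-suc : ∀ b n → digits (2 + b) (suc n) ≡ suc n % (2 + b) ∷ digits (2 + b) (suc n / (2 + b))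
digits-suc b n = cong (suc n % (2 + b) ∷_) (digitsF-fuel b n (suc n / (2 + b)) (suc n / (2 + b)) (quotient≤ b n) ℕ.≤-refl)

DigitBound : ℕ → ℕ → ℕ → Set
DigitBound B N p = 2 * normSq (digits B p) < p ⊎ 2 * normSq (digits B p) < N

digitBound? : ∀ B N p → Dec (DigitBound B N p)
digitBound? B N p = (_ <? p) ⊎-dec (_ <? N)

-- Beyond N (2 + b), dropping the last digit d costs 2 d² ≤ (1 + b) N on the left and at least as much on the right.
digitBound : ∀ b N → 2 * suc b ≤ N → All (DigitBound (2 + b) N) (downFrom (N * (2 + b))) →
             ∀ p → DigitBound (2 + b) N p
digitBound b N 2b≤N small = <-rec (DigitBound B N) step
  where
  B = 2 + b
  s : ℕ → ℕ
  s p = normSq (digits B p)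

  large : ∀ n → N ≤ suc n / B → DigitBound B N (suc n / B) → 2 * s (suc n) < suc n
  large n N≤p′ ih = begin-strict
    2 * s p                          ≡⟨ cong (λ ds → 2 * normSq ds) (digits-suc b n) ⟩
    2 * (d * d + s p′)               ≡⟨ rearrange d (s p′) ⟩
    d * (2 * d) + 2 * s p′           <⟨ ℕ.+-mono-≤-< 2d²≤ 2sp′< ⟩
    suc b * p′ + p′                  ≡⟨ ℕ.+-comm (suc b * p′) p′ ⟩
    B * p′                           ≡⟨ ℕ.*-comm B p′ ⟩
    p′ * B                           ≤⟨ ℕ.m≤n+m (p′ * B) d ⟩
    d + p′ * B                       ≡⟨ m≡m%n+[m/n]*n p B ⟨
    p                                ∎
    where
    open ℕ.≤-Reasoning
    p = suc n
    p′ = p / B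
    d = p % B
    d≤ : d ≤ suc b
    d≤ = ℕ.≤-pred (m%n<n p B)
    2d²≤ : d * (2 * d) ≤ suc b * p′
    2d²≤ = ℕ.*-mono-≤ d≤ (ℕ.≤-trans (ℕ.*-monoʳ-≤ 2 d≤) (ℕ.≤-trans 2b≤N N≤p′))
    2sp′< : 2 * s p′ < p′
    2sp′< = [ (λ lt → lt) , (λ lt → ℕ.<-≤-trans lt N≤p′) ]′ ih
    rearrange : ∀ d t → 2 * (d * d + t) ≡ d * (2 * d) + 2 * t
    rearrange = ℕSolver.solve-∀

  step : ∀ p → (∀ {k} → k < p → DigitBound B N k) → DigitBound B N p
  step p ih with p <? N * B
  step p       ih | yes p<NB = All.lookup small (∈-downFrom⁺ p<NB)
  step zero    ih | no  p≮NB =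
    -- `N` and the base are both positive, so 0 is among the tabulated values.
    contradiction (ℕ.*-mono-≤ (ℕ.≤-trans (s≤s z≤n) 2b≤N) (s≤s {0} {suc b} z≤n)) p≮NB
  step (suc n) ih | no  p≮NB = inj₁ (large n N≤p′ (ih (m/n<m (suc n) B (s≤s (s≤s z≤n)))))
    where
    N≤p′ : N ≤ suc n / B
    N≤p′ = subst (_≤ suc n / B) (m*n/n≡m N B) (/-monoˡ-≤ B (ℕ.≮⇒≥ p≮NB))

-- The dominating square sum may belong to the coordinate that is still below `N`, where it need not
-- be smaller than that coordinate. The second alternative of `DigitBound` covers this, as
-- `N ≤ p + q`.
descent-outside-box : ∀ {B N p q} → (∀ k → DigitBound B N k) → N ≤ p ⊎ N ≤ q → size (magS B (p , q)) < p + q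
descent-outside-box {B} {N} {p} {q} bound outside =
  [ (λ le → ℕ.≤-<-trans le (below (ℕ.m≤m+n p q) (bound p)))
  , (λ le → ℕ.≤-<-trans le (below (ℕ.m≤n+m q p) (bound q)))
  ]′ (size-magSq≤ (digits B p) (digits B q))
  where
  N≤p+q : N ≤ p + q
  N≤p+q = [ ℕ.m≤n⇒m≤n+o q , ℕ.m≤n⇒m≤o+n p ]′ outside

  below : ∀ {k t} → k ≤ p + q → t < k ⊎ t < N → t < p + q
  below k≤p+q = [ (λ t<k → ℕ.<-≤-trans t<k k≤p+q) , (λ t<N → ℕ.<-≤-trans t<N N≤p+q) ]′

-- Certificates

_≟G_ : DecidableEquality G
_≟G_ = Product.≡-dec ℤ._≟_ ℤ._≟_

_≟M_ : DecidableEquality Mag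
_≟M_ = Product.≡-dec ℕ._≟_ ℕ._≟_

open DecMembership _≟G_ using () renaming (_∈?_ to _∈G?_)
open DecMembership _≟M_ using () renaming (_∈?_ to _∈M?_)

-- Testing membership in M only at the end is no loss when magS B preserves M.
descends : ℕ → List Mag → ℕ → ℕ → Mag → Bool
descends B M zero    m x = ⌊ x ∈M? M ⌋
descends B M (suc k) m x = (size x <ᵇ m) ∨ descends B M k m (magS B x)

descends-eventually : ∀ {B M m} k x → T (descends B M k m x) → Eventually (magS B) (λ y → size y < m ⊎ y ∈ M) x
descends-eventually             zero    x d = 0 , inj₂ (toWitness d)
descends-eventually {B} {M} {m} (suc k) x d with Equivalence.to (T-∨ {size x <ᵇ m}) d
... | inj₁ lt = 0 , inj₁ (ℕ.<ᵇ⇒< (size x) m lt)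
... | inj₂ d′ = eventually-step (magS B) {λ y → size y < m ⊎ y ∈ M} (descends-eventually k (magS B x) d′)

cyclic : ℕ → List G
cyclic B = concat (listed B)

cyclicMags : ℕ → List Mag
cyclicMags B = map mag (cyclic B)

withMag : Mag → List G
withMag (p , q) = (+ p , + q) ∷ (+ p , ℤ.- + q) ∷ (ℤ.- + p , + q) ∷ (ℤ.- + p , ℤ.- + q) ∷ []

∈-withMag : ∀ x → x ∈ withMag (mag x)
∈-withMag (+ _      , + _     ) = here refl
∈-withMag (+ _      , -[1+ _ ]) = there (here refl)
∈-withMag (-[1+ _ ] , + _     ) = there (there (here refl))
∈-withMag (-[1+ _ ] , -[1+ _ ]) = there (there (there (here refl)))

boxDescends : ℕ → ℕ → ℕ → Bool
boxDescends B N K = all (λ p → all (λ q → descends B (cyclicMags B) K (p + q) (magS B (p , q))) (downFrom N)) (downFrom N)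

boxDescends-sound : ∀ {B N K p q} → T (boxDescends B N K) → p < N → q < N →
                    T (descends B (cyclicMags B) K (p + q) (magS B (p , q)))
boxDescends-sound {B} {N} {K} {p} t p<N q<N =
  All.lookup (All.all⁺ _ (downFrom N) (All.lookup (All.all⁺ _ (downFrom N) t) (∈-downFrom⁺ p<N))) (∈-downFrom⁺ q<N)

-- The first two components feed `digitBound`, and the third gives descent inside the box. The last
-- one recovers the signs lost in passing to absolute values: for every choice of signs on listed
-- absolute values, one step of `S B` lands on a listed point.
Certificate : ℕ → ℕ → ℕ → Set
Certificate B N K =
    2 * (B ∸ 1) ≤ N
  × All (DigitBound B N) (downFrom (N * B))
  × T (boxDescends B N K)
  × All (IsCycle (S B)) (listed B)
  × All (λ m → All (λ x → S B x ∈ cyclic B) (withMag m)) (cyclicMags B)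

certificate? : ∀ B N K → Dec (Certificate B N K)
certificate? B N K =
        (2 * (B ∸ 1) ≤? N)
  ×-dec All.all? (digitBound? B N) (downFrom (N * B))
  ×-dec T? (boxDescends B N K)
  ×-dec All.all? (isCycle? (S B) _≟G_) (listed B)
  ×-dec All.all? (λ m → All.all? (λ x → S B x ∈G? cyclic B) (withMag m)) (cyclicMags B)

-- Orbits reach listed points, and the resulting classification of cycles

module _ b N K (certificate : Certificate (2 + b) N K) where

  private
    B = 2 + b
    bound : ∀ p → DigitBound B N p
    bound = digitBound b N (proj₁ certificate) (proj₁ (proj₂ certificate))
    box = proj₁ (proj₂ (proj₂ certificate))
    cycles = proj₁ (proj₂ (proj₂ (proj₂ certificate)))
    signs = proj₂ (proj₂ (proj₂ (proj₂ certificate)))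

  magnitude-descends : ∀ x → Eventually (magS B) (λ y → size y < size x ⊎ y ∈ cyclicMags B) (magS B x)
  magnitude-descends (p , q) with p <? N | q <? N
  ... | yes p<N | yes q<N =
    descends-eventually K _ (boxDescends-sound {B} {N} {K} {p} {q} box p<N q<N)
  -- No further iteration is needed: the single application of `magS B` in the goal already lowers
  -- the size.
  ... | no p≮N  | _       = 0 , inj₁ (descent-outside-box bound (inj₁ (ℕ.≮⇒≥ p≮N)))
  ... | yes _   | no q≮N  = 0 , inj₁ (descent-outside-box bound (inj₂ (ℕ.≮⇒≥ q≮N)))

  magnitude-eventually-cyclic : ∀ x → Eventually (magS B) (_∈ cyclicMags B) x
  magnitude-eventually-cyclic x = go x (<-wellFounded (size x))
    where
    go : ∀ x → Acc _<_ (size x) → Eventually (magS B) (_∈ cyclicMags B) x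
    go x (acc smaller) with magnitude-descends x
    ... | n , inj₁ lt  = eventually-step (magS B) {_∈ cyclicMags B}
                           (eventually-fold (magS B) {_∈ cyclicMags B} n (go _ (smaller lt)))
    ... | n , inj₂ y∈M = eventually-step (magS B) {_∈ cyclicMags B} (n , y∈M)

  -- This serves twice: it turns listed absolute values into a listed point, and it shows that `S B`
  -- preserves the set of listed points.
  S-cyclic : ∀ x → mag x ∈ cyclicMags B → S B x ∈ cyclic B
  S-cyclic x m∈ = All.lookup (All.lookup signs m∈) (∈-withMag x)

  eventually-cyclic : ∀ x → Eventually (S B) (_∈ cyclic B) x
  eventually-cyclic x with n , y∈M ← magnitude-eventually-cyclic (mag x) =
    suc n , S-cyclic (fold x (S B) n) (subst (_∈ cyclicMags B) (sym (mag-fold-S B x n)) y∈M)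

  cycle⇒listed : ∀ l → IsCycle (S B) l → Any (λ c → ∃ λ k → l ≡ rotate k c) (listed B)
  cycle⇒listed []      (ne , _) = contradiction refl ne
  cycle⇒listed (x ∷ l) cyc
    with c , x∈c , c∈listed ← ∈-concat⁻′ (listed B)
           -- The head `x` is periodic with the length of the cycle as period, and its orbit enters
           -- the absorbing set of listed points, so `x` itself is listed.
           (periodic-absorbed (S B) {_∈ cyclic B} {n = length l} (λ y y∈ → S-cyclic y (∈-map⁺ mag y∈))
             (iterate-path (S B) x l (proj₂ (proj₂ cyc))) (eventually-cyclic x))
    -- Rotating `c` to start at `x` gives two cycles with the same head, which must coincide.
    with k , m , eq ← rotate-to x∈c =
    lose c∈listed (k , trans (cycle-unique (S B) cyc (subst (IsCycle (S B)) eq rotated)) (sym eq))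
    where
    rotated : IsCycle (S B) (rotate k c)
    rotated = isCycle-rotate (S B) k (All.lookup cycles c∈listed)

  listed⇒cycle : ∀ l → Any (λ c → ∃ λ k → l ≡ rotate k c) (listed B) → IsCycle (S B) l
  listed⇒cycle l rotation with cyc , k , eq ← All.lookupAny cycles rotation =
    subst (IsCycle (S B)) (sym eq) (isCycle-rotate (S B) k cyc)

  cycle⇔listed : ∀ l → IsCycle (S B) l ⇔ Any (λ c → ∃ λ k → l ≡ rotate k c) (listed B)
  cycle⇔listed l = mk⇔ (cycle⇒listed l) (listed⇒cycle l)

-- The values of N below are the least for which the digit bound holds. Within 80 steps every orbit of magS starting
-- in the box drops below its initial size or becomes periodic.
certified : ∀ b N K {_ : True (certificate? (2 + b) N K)} l →
            IsCycle (S (2 + b)) l ⇔ Any (λ c → ∃ λ k → l ≡ rotate k c) (listed (2 + b))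
certified b N K {c} = cycle⇔listed b N K (toWitness c)

theorem6 : (B : ℕ) → 2 ≤ B → B ≤ 10 → (l : List G) →
    (l ≢ [] × Unique l × map (S B) l ≡ rotate 1 l)
    ⇔ Any (λ c → ∃ λ k → l ≡ rotate k c) (listed B)
theorem6 2  _ _ = certified 0 5 80
theorem6 3  _ _ = certified 1 19 80
theorem6 4  _ _ = certified 2 39 80
theorem6 5  _ _ = certified 3 67 80
theorem6 6  _ _ = certified 4 109 80
theorem6 7  _ _ = certified 5 153 80
theorem6 8  _ _ = certified 6 205 80
theorem6 9  _ _ = certified 7 265 80
theorem6 10 _ _ = certified 8 333 80
theorem6 0 () _
theorem6 1 (s≤s ()) _
theorem6 (suc (suc (suc (suc (suc (suc (suc (suc (suc (suc (suc _))))))))))) _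
  (s≤s (s≤s (s≤s (s≤s (s≤s (s≤s (s≤s (s≤s (s≤s (s≤s ()))))))))))
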